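{- Let $n\ge 1$ and $[n]=\{1,\dots,n\}$. Each single-peaked preference $\sigma=i_1 i_2\cdots i_n$ on $[n]$ has a sign representation, i.e. a well-defined sequence $s(\sigma)=(s_1,\dots,s_{n-1})\in\{+,-\}^{n-1}$ of length $n-1$ (as defined in the context), and this sequence uniquely specifies the preference: if $\sigma,\tau$ are single-peaked preferences on $[n]$ with $s(\sigma)=s(\tau)$, then $\sigma=\tau$.
   Context: A preference (linear order) $\sigma$ on $[n]=\{1,\dots,n\}$ is written as a word $i_1 i_2\cdots i_n$, a permutation of $[n]$ listed from the most preferred alternative $i_1$ (the top, or peak) to the least preferred $i_n$. Write $a\succ b$ if $a$ is preferred to $b$, i.e. $a$ occurs before $b$ in the word. The preference with peak $k=i_1$ is single-peaked (with respect to the fixed axis $1<2<\cdots<n$) if for all $k_1,k_2\in[n]$, $k_2<k_1\le k$ or $k_2>k_1\ge k$ implies $k_1\succ k_2$. Sign representation: for a preference $\sigma=i_1\cdots i_n$ and $1\le p\le n-1$, the sign $s_p$ is $+$ if $i_{p+1}=\max\{i_1,\dots,i_p\}+1$, and $s_p$ is $-$ if $i_{p+1}=\min\{i_1,\dots,i_p\}-1$. The sequence $s(\sigma)=(s_1,\dots,s_{n-1})$ is well defined when for every $p$ exactly one of these two cases occurs. For example, with $n=5$, $34251$ has sign representation $+-+-$, and $23415$ has sign representation $++-+$. -}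

module Defs where

open import Data.Fin using (Fin; zero; suc; toℕ; _<_; _≤_)
open import Data.Fin.Permutation using (Permutation′; _⟨$⟩ʳ_; _⟨$⟩ˡ_)
open import Data.Fin.Properties using (≤-totalOrder)
open import Data.List using (List; take; tabulate)
import Data.List.Extrema as Extrema
open import Data.Nat using (ℕ)
open import Data.Product using (_×_)
open import Data.Sign using (Sign; +; -)
open import Data.Sum using (_⊎_; inj₁; inj₂)
open import Data.Vec as Vec using (Vec)
open import Relation.Binary.PropositionalEquality using (_≡_)
open import Relation.Nullary using (¬_)

-- The alternatives 1, …, n are represented by 0, …, n-1 in Fin n, and so are
-- the positions in a word: σ ⟨$⟩ʳ q is the alternative at position q, and
-- σ ⟨$⟩ˡ a is the position of the alternative a.
Preference : ℕ → Set
Preference n = Permutation′ n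

Prefers : ∀ {n} → Preference n → Fin n → Fin n → Set
Prefers σ a b = σ ⟨$⟩ˡ a < σ ⟨$⟩ˡ b

word : ∀ {n} → Preference n → List (Fin n)
word σ = tabulate (σ ⟨$⟩ʳ_)

module _ {m : ℕ} where

  open Extrema (≤-totalOrder (ℕ.suc m)) using (max; min)

  peak : Preference (ℕ.suc m) → Fin (ℕ.suc m)
  peak σ = σ ⟨$⟩ʳ zero

  SinglePeaked : Preference (ℕ.suc m) → Set
  SinglePeaked σ = ∀ k₁ k₂ →
    (k₂ < k₁ × k₁ ≤ peak σ) ⊎ (k₁ < k₂ × peak σ ≤ k₁) →
    Prefers σ k₁ k₂

  -- The index p : Fin m stands for toℕ p + 1 ∈ {1, …, n-1}, where n = m + 1.
  -- Hence the prefix below is i₁, …, i_{toℕ p + 1}, and the letter after it is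
  -- σ ⟨$⟩ʳ suc p.
  prefix : Preference (ℕ.suc m) → Fin m → List (Fin (ℕ.suc m))
  prefix σ p = take (ℕ.suc (toℕ p)) (word σ)

  -- The first argument of the library's max and min is a default that also
  -- takes part in the comparison.  The peak is a member of every prefix, so
  -- these are the maximum and minimum of the prefix itself.
  prefixMax prefixMin : Preference (ℕ.suc m) → Fin m → Fin (ℕ.suc m)
  prefixMax σ p = max (peak σ) (prefix σ p)
  prefixMin σ p = min (peak σ) (prefix σ p)

  -- The equation x = min - 1 is written x + 1 = min, since subtraction on ℕ
  -- would be truncated.
  HasSign : Preference (ℕ.suc m) → Fin m → Sign → Set
  HasSign σ p + = toℕ (σ ⟨$⟩ʳ suc p) ≡ ℕ.suc (toℕ (prefixMax σ p))
  HasSign σ p - = ℕ.suc (toℕ (σ ⟨$⟩ʳ suc p)) ≡ toℕ (prefixMin σ p)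

  ExactlyOneSign : Preference (ℕ.suc m) → Fin m → Set
  ExactlyOneSign σ p =
    (HasSign σ p + × ¬ HasSign σ p -) ⊎ (¬ HasSign σ p + × HasSign σ p -)

  SignsWellDefined : Preference (ℕ.suc m) → Set
  SignsWellDefined σ = ∀ p → ExactlyOneSign σ p

  sign : (σ : Preference (ℕ.suc m)) (p : Fin m) → ExactlyOneSign σ p → Sign
  sign σ p (inj₁ _) = +
  sign σ p (inj₂ _) = -

  signs : (σ : Preference (ℕ.suc m)) → SignsWellDefined σ → Vec Sign m
  signs σ d = Vec.tabulate (λ p → sign σ p (d p))

{-# OPTIONS --safe #-}
-- In a single-peaked word the letter after a prefix is adjacent to the interval
-- spanned by that prefix: an alternative strictly between the two would have to
-- occur earlier.  Equal signs therefore make two words agree up to translation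
-- by the difference of their peaks.  As both words contain the least
-- alternative, that difference is zero.
module Submission where

open import Defs
open import Data.Fin using (Fin; zero; suc; toℕ; fromℕ<; _<_; _≤_)
open import Data.Fin.Permutation using (_≈_; _⟨$⟩ʳ_; _⟨$⟩ˡ_; inverseˡ; inverseʳ)
open import Data.Fin.Properties
  using (≤-totalOrder; toℕ-injective; toℕ-fromℕ<; toℕ<n; <-cmp)
open import Data.List using (take; tabulate)
import Data.List.Extrema as Extrema
open import Data.List.Membership.Propositional using (_∈_)
open import Data.List.Relation.Unary.All using (All; []; _∷_; lookup)
open import Data.List.Relation.Unary.Any using (here; there)
open import Data.Nat as ℕ using (ℕ; suc; z<s; s<s; s<s⁻¹)
import Data.Nat.Properties as ℕ
open import Data.Product using (Σ-syntax; ∃-syntax; _×_; _,_)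
open import Data.Sign using (Sign; +; -)
open import Data.Sum using (inj₁; inj₂)
import Data.Vec as Vec
open import Data.Vec.Properties using (lookup∘tabulate)
open import Function using (_∘_; id)
open import Relation.Binary.Definitions using (tri<; tri≈; tri>)
open import Relation.Binary.PropositionalEquality
  using (_≡_; _≢_; refl; sym; trans; cong; subst; subst₂)
open import Relation.Nullary using (¬_; contradiction)

-- With `∈-take-tabulate`, this lets the list extrema `max` and `min` be handled through word
-- positions.
All-take-tabulate : ∀ {a p} {A : Set a} {P : A → Set p} {n} (k : ℕ) (f : Fin n → A) →
  (∀ q → toℕ q ℕ.< k → P (f q)) → All P (take k (tabulate f))
All-take-tabulate ℕ.zero  f h = []
All-take-tabulate {n = ℕ.zero} (suc k) f h = []
All-take-tabulate {n = suc n}  (suc k) f h =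
  h zero z<s ∷ All-take-tabulate k (f ∘ suc) (λ q → h (suc q) ∘ s<s)

∈-take-tabulate : ∀ {a} {A : Set a} {n} (k : ℕ) (f : Fin n → A) (q : Fin n) →
  toℕ q ℕ.< k → f q ∈ take k (tabulate f)
∈-take-tabulate (suc k) f zero    _   = here refl
∈-take-tabulate (suc k) f (suc q) q<k = there (∈-take-tabulate k (f ∘ suc) q (s<s⁻¹ q<k))

letter-injective : ∀ {n} (σ : Preference n) {i j} → σ ⟨$⟩ʳ i ≡ σ ⟨$⟩ʳ j → i ≡ j
letter-injective σ eq = trans (sym (inverseˡ σ)) (trans (cong (σ ⟨$⟩ˡ_) eq) (inverseˡ σ))

module _ {m : ℕ} where

  open Extrema (≤-totalOrder (suc m))

  module _ (σ : Preference (suc m)) (p : Fin m) where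

    prefixMax-attained : ∃[ q ] q < suc p × prefixMax σ p ≡ σ ⟨$⟩ʳ q
    prefixMax-attained = argmax-all id {P = λ x → ∃[ q ] q < suc p × x ≡ σ ⟨$⟩ʳ q}
      -- The default `peak σ` of `max` must satisfy the predicate too; it is the letter at position
      -- `zero`.
      (zero , z<s , refl)
      (All-take-tabulate (suc (toℕ p)) (σ ⟨$⟩ʳ_) (λ q q≤p → q , q≤p , refl))

    prefixMin-attained : ∃[ q ] q < suc p × prefixMin σ p ≡ σ ⟨$⟩ʳ q
    prefixMin-attained = argmin-all id {P = λ x → ∃[ q ] q < suc p × x ≡ σ ⟨$⟩ʳ q}
      (zero , z<s , refl)
      (All-take-tabulate (suc (toℕ p)) (σ ⟨$⟩ʳ_) (λ q q≤p → q , q≤p , refl))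

    letter≤prefixMax : ∀ q → q < suc p → σ ⟨$⟩ʳ q ≤ prefixMax σ p
    letter≤prefixMax q q≤p = lookup (xs≤max (peak σ) (prefix σ p))
      (∈-take-tabulate (suc (toℕ p)) (σ ⟨$⟩ʳ_) q q≤p)

    prefixMin≤letter : ∀ q → q < suc p → prefixMin σ p ≤ σ ⟨$⟩ʳ q
    prefixMin≤letter q q≤p = lookup (min≤xs (peak σ) (prefix σ p))
      (∈-take-tabulate (suc (toℕ p)) (σ ⟨$⟩ʳ_) q q≤p)

    -- A letter of sign `-` lies below the prefix minimum, which is at most the peak.
    above-peak⇒¬- : peak σ < σ ⟨$⟩ʳ suc p → ¬ HasSign σ p -
    above-peak⇒¬- peak<x eq = ℕ.<-asym peak<x
      (ℕ.≤-trans (ℕ.≤-reflexive eq) (prefixMin≤letter zero z<s))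

    below-peak⇒¬+ : σ ⟨$⟩ʳ suc p < peak σ → ¬ HasSign σ p +
    below-peak⇒¬+ x<peak eq = ℕ.<-asym x<peak
      (ℕ.≤-trans (s<s (letter≤prefixMax zero z<s)) (ℕ.≤-reflexive (sym eq)))

    prefers-next⇒in-prefix : ∀ {a} → Prefers σ a (σ ⟨$⟩ʳ suc p) → σ ⟨$⟩ˡ a < suc p
    prefers-next⇒in-prefix {a} = subst (σ ⟨$⟩ˡ a <_) (inverseˡ σ)

    next-not-preferred : ∀ q → q < suc p → ¬ Prefers σ (σ ⟨$⟩ʳ suc p) (σ ⟨$⟩ʳ q)
    next-not-preferred q q≤p = ℕ.<-asym q≤p ∘ subst₂ _<_ (inverseˡ σ) (inverseˡ σ)

    next-fresh : ∀ q → q < suc p → toℕ (σ ⟨$⟩ʳ q) ≢ toℕ (σ ⟨$⟩ʳ suc p)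
    next-fresh q q≤p eq =
      ℕ.<-irrefl (cong toℕ (letter-injective σ (toℕ-injective eq))) q≤p

    module _ (sp : SinglePeaked σ) where

      above-peak⇒+ : peak σ < σ ⟨$⟩ʳ suc p → HasSign σ p +
      above-peak⇒+ peak<x = ℕ.≤-antisym (ℕ.≮⇒≥ no-gap) max<x
        where
        x = σ ⟨$⟩ʳ suc p

        max<x : prefixMax σ p < x
        max<x with q , q≤p , eq ← prefixMax-attained = subst (_< x) (sym eq)
          -- If the maximum `y` exceeded `x`, both would lie above the peak with `x` nearer to it,
          -- so `x` would come before `y`.
          (ℕ.≤∧≢⇒< (ℕ.≮⇒≥ (λ x<y → next-not-preferred q q≤p
                     (sp _ _ (inj₂ (x<y , ℕ.<⇒≤ peak<x)))))
                   (next-fresh q q≤p))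

        no-gap : ¬ suc (toℕ (prefixMax σ p)) ℕ.< toℕ x
        no-gap gap = ℕ.<-irrefl refl (subst (ℕ._≤ toℕ (prefixMax σ p)) y≡ y≤max)
          where
          -- The alternative just above the maximum is preferred to `x`, hence in the prefix, where
          -- it beats the maximum.
          y = fromℕ< (ℕ.<-trans gap (toℕ<n x))
          y≡ : toℕ y ≡ suc (toℕ (prefixMax σ p))
          y≡ = toℕ-fromℕ< (ℕ.<-trans gap (toℕ<n x))
          y≻x : Prefers σ y x
          y≻x = sp y x (inj₂
            ( subst (ℕ._< toℕ x) (sym y≡) gap
            , subst (toℕ (peak σ) ℕ.≤_) (sym y≡) (ℕ.m≤n⇒m≤1+n (letter≤prefixMax zero z<s))))
          y≤max : y ≤ prefixMax σ p
          y≤max = subst (_≤ prefixMax σ p) (inverseʳ σ) (letter≤prefixMax (σ ⟨$⟩ˡ y) (prefers-next⇒in-prefix y≻x))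

      below-peak⇒- : σ ⟨$⟩ʳ suc p < peak σ → HasSign σ p -
      below-peak⇒- x<peak = ℕ.≤-antisym x<min (ℕ.≮⇒≥ no-gap)
        where
        x = σ ⟨$⟩ʳ suc p

        x<min : x < prefixMin σ p
        x<min with q , q≤p , eq ← prefixMin-attained = subst (x <_) (sym eq)
          (ℕ.≤∧≢⇒< (ℕ.≮⇒≥ (λ y<x → next-not-preferred q q≤p
                     (sp _ _ (inj₁ (y<x , ℕ.<⇒≤ x<peak)))))
                   (next-fresh q q≤p ∘ sym))

        no-gap : ¬ suc (toℕ x) ℕ.< toℕ (prefixMin σ p)
        no-gap gap = ℕ.<⇒≱ gap (subst (toℕ (prefixMin σ p) ℕ.≤_) y≡ min≤y)
          where
          -- The candidate sits just above `x` rather than just below the minimum: this avoids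
          -- subtraction, and `x<peak` itself says that it is at most the peak.
          y = fromℕ< (ℕ.<-trans gap (toℕ<n (prefixMin σ p)))
          y≡ : toℕ y ≡ suc (toℕ x)
          y≡ = toℕ-fromℕ< (ℕ.<-trans gap (toℕ<n (prefixMin σ p)))
          y≻x : Prefers σ y x
          y≻x = sp y x (inj₁
            ( subst (toℕ x ℕ.<_) (sym y≡) ℕ.≤-refl
            , subst (ℕ._≤ toℕ (peak σ)) (sym y≡) x<peak))
          min≤y : prefixMin σ p ≤ y
          min≤y = subst (prefixMin σ p ≤_) (inverseʳ σ) (prefixMin≤letter (σ ⟨$⟩ˡ y) (prefers-next⇒in-prefix y≻x))

      -- The side of the peak on which the next letter lies decides the sign; it cannot be the peak,
      -- which is already used.
      exactlyOneSign : ExactlyOneSign σ p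
      exactlyOneSign with <-cmp (σ ⟨$⟩ʳ suc p) (peak σ)
      ... | tri< x<peak _ _ = inj₂ (below-peak⇒¬+ x<peak , below-peak⇒- x<peak)
      ... | tri≈ _ x≡peak _ = contradiction (sym (cong toℕ x≡peak)) (next-fresh zero z<s)
      ... | tri> _ _ peak<x = inj₁ (above-peak⇒+ peak<x , above-peak⇒¬- peak<x)

    sign-correct : (d : ExactlyOneSign σ p) → HasSign σ p (sign σ p d)
    sign-correct (inj₁ (h , _)) = h
    sign-correct (inj₂ (_ , h)) = h

  lookup-signs : ∀ σ (d : SignsWellDefined σ) p → HasSign σ p (Vec.lookup (signs σ d) p)
  lookup-signs σ d p = subst (HasSign σ p)
    (sym (lookup∘tabulate (λ p → sign σ p (d p)) p)) (sign-correct σ p (d p))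

  -- a is to the peak of σ as b is to the peak of τ: a - peak σ = b - peak τ, with
  -- the subtractions moved across.
  SameOffset : (σ τ : Preference (suc m)) (a b : Fin (suc m)) → Set
  SameOffset σ τ a b = toℕ a ℕ.+ toℕ (peak τ) ≡ toℕ b ℕ.+ toℕ (peak σ)

  SameOffsetAt : (σ τ : Preference (suc m)) → Fin (suc m) → Set
  SameOffsetAt σ τ q = SameOffset σ τ (σ ⟨$⟩ʳ q) (τ ⟨$⟩ʳ q)

  -- At the position where `σ` attains its maximum, `τ` has a letter of the same offset, bounded by
  -- its own maximum. Swapping `σ` and `τ` gives the converse inequality.
  prefixMax-offset-≤ : ∀ σ τ p → (∀ q → q < suc p → SameOffsetAt σ τ q) →
    toℕ (prefixMax σ p) ℕ.+ toℕ (peak τ) ℕ.≤ toℕ (prefixMax τ p) ℕ.+ toℕ (peak σ)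
  prefixMax-offset-≤ σ τ p h with q , q≤p , eq ← prefixMax-attained σ p rewrite eq =
    ℕ.≤-trans (ℕ.≤-reflexive (h q q≤p)) (ℕ.+-monoˡ-≤ _ (letter≤prefixMax τ p q q≤p))

  prefixMin-offset-≥ : ∀ σ τ p → (∀ q → q < suc p → SameOffsetAt σ τ q) →
    toℕ (prefixMin τ p) ℕ.+ toℕ (peak σ) ℕ.≤ toℕ (prefixMin σ p) ℕ.+ toℕ (peak τ)
  prefixMin-offset-≥ σ τ p h with q , q≤p , eq ← prefixMin-attained σ p rewrite eq =
    ℕ.≤-trans (ℕ.+-monoˡ-≤ _ (prefixMin≤letter τ p q q≤p)) (ℕ.≤-reflexive (sym (h q q≤p)))

  same-sign⇒SameOffsetAt : ∀ σ τ p s → HasSign σ p s → HasSign τ p s →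
    (∀ q → q < suc p → SameOffsetAt σ τ q) → SameOffsetAt σ τ (suc p)
  same-sign⇒SameOffsetAt σ τ p + hσ hτ h rewrite hσ | hτ = cong suc
    (ℕ.≤-antisym (prefixMax-offset-≤ σ τ p h)
                 (prefixMax-offset-≤ τ σ p (λ q q≤p → sym (h q q≤p))))
  -- Sign `-` determines only the successor of the letter, so the offsets are compared one step up
  -- and `suc` is cancelled.
  same-sign⇒SameOffsetAt σ τ p - hσ hτ h = ℕ.suc-injective
    (subst₂ (λ a b → a ℕ.+ toℕ (peak τ) ≡ b ℕ.+ toℕ (peak σ)) (sym hσ) (sym hτ)
      (ℕ.≤-antisym (prefixMin-offset-≥ τ σ p (λ q q≤p → sym (h q q≤p)))
                   (prefixMin-offset-≥ σ τ p h)))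

  same-signs⇒SameOffsetAt : ∀ σ τ (s : Fin m → Sign) →
    (∀ p → HasSign σ p (s p)) → (∀ p → HasSign τ p (s p)) → ∀ q → SameOffsetAt σ τ q
  same-signs⇒SameOffsetAt σ τ s hσ hτ q = below (suc (toℕ q)) q ℕ.≤-refl
    where
    -- Strong induction, with `k` as bound: the prefix extrema depend on all earlier letters. At
    -- `zero` both letters are peaks.
    below : ∀ k q → toℕ q ℕ.< k → SameOffsetAt σ τ q
    below (suc k) zero    _   = ℕ.+-comm (toℕ (peak σ)) (toℕ (peak τ))
    below (suc k) (suc p) p<k = same-sign⇒SameOffsetAt σ τ p (s p) (hσ p) (hτ p)
      (λ q q≤p → below k q (ℕ.<-≤-trans q≤p (s<s⁻¹ p<k)))

  -- Compare the two words at the position where τ has the least alternative.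
  SameOffsetAt⇒peak-≤ : ∀ σ τ → (∀ q → SameOffsetAt σ τ q) → peak τ ≤ peak σ
  SameOffsetAt⇒peak-≤ σ τ h = ℕ.m+n≤o⇒n≤o (toℕ (σ ⟨$⟩ʳ q))
    (ℕ.≤-reflexive (trans (h q) (cong (λ a → toℕ a ℕ.+ toℕ (peak σ)) (inverseʳ τ))))
    where q = τ ⟨$⟩ˡ zero

  SameOffsetAt⇒≈ : ∀ σ τ → (∀ q → SameOffsetAt σ τ q) → σ ≈ τ
  SameOffsetAt⇒≈ σ τ h q = toℕ-injective (ℕ.+-cancelʳ-≡ (toℕ (peak τ)) _ _
    (trans (h q) (cong (toℕ (τ ⟨$⟩ʳ q) ℕ.+_) peaks≡)))
    where
    -- The hypothesis is symmetric in the two words, so each peak bounds the other.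
    peaks≡ : toℕ (peak σ) ≡ toℕ (peak τ)
    peaks≡ = ℕ.≤-antisym (SameOffsetAt⇒peak-≤ τ σ (sym ∘ h)) (SameOffsetAt⇒peak-≤ σ τ h)

theorem1 : (m : ℕ) →
    Σ[ wd ∈ ((σ : Preference (suc m)) → SinglePeaked σ → SignsWellDefined σ) ]
    ((σ τ : Preference (suc m)) (spσ : SinglePeaked σ) (spτ : SinglePeaked τ) →
    signs σ (wd σ spσ) ≡ signs τ (wd τ spτ) → σ ≈ τ)
theorem1 m = wd , unique
  where
  wd : (σ : Preference (suc m)) → SinglePeaked σ → SignsWellDefined σ
  wd σ sp p = exactlyOneSign σ p sp

  unique : ∀ σ τ spσ spτ → signs σ (wd σ spσ) ≡ signs τ (wd τ spτ) → σ ≈ τ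
  unique σ τ spσ spτ eq = SameOffsetAt⇒≈ σ τ
    -- The sign vector of `σ` serves as the common sequence; `eq` carries the signs of `τ` over to
    -- it.
    (same-signs⇒SameOffsetAt σ τ (Vec.lookup (signs σ (wd σ spσ)))
      (lookup-signs σ (wd σ spσ))
      (λ p → subst (λ v → HasSign τ p (Vec.lookup v p)) (sym eq)
               (lookup-signs τ (wd τ spτ) p)))
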